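{- Let $H$ be a $3$-uniform hypergraph on $n$ vertices such that every pair of distinct vertices of $H$ is contained in at least one edge (i.e. $\delta_2(H)\geq 1$). Then at least one of the following holds: (T1) $\mathrm{mc}_3(H)\geq n-\alpha^*_3(H)$; or (T2) there exist a $3$-coloring (with colors blue, red, green) of the edges of $H$ and a partition $\{V_1,V_2,V_3,V_4\}$ of $V(H)$ into four nonempty parts with $|V_1|\geq |V_2|\geq |V_3|\geq |V_4|$ and $\alpha^*_3(H)\geq |V_2|\geq |V_3|\geq |V_4|$, and consequently $|V_1|+|V_i|\geq n-2\alpha_3^*(H)$ for all $i\in\{2,3,4\}$, such that: no edge of $H$ intersects three of the sets $V_1,V_2,V_3,V_4$; every edge which intersects both $V_1$ and $V_2$ and every edge which intersects both $V_3$ and $V_4$ is blue; every edge which intersects both $V_1$ and $V_3$ and every edge which intersects both $V_2$ and $V_4$ is red; and every edge which intersects both $V_1$ and $V_4$ and every edge which intersects both $V_2$ and $V_3$ is green. In particular, for every $3$-uniform hypergraph $H$ on $n$ vertices with $\delta_2(H)\geq 1$, we have $\mathrm{mc}_3(H)\geq n-2\alpha^*_3(H)$.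
   Context: Hypergraphs are finite with nonempty vertex set. For $\{u,v\}\in\binom{V(H)}{2}$, $d(u,v)$ is the number of edges of $H$ containing $\{u,v\}$, and $\delta_2(H)=\min\{d(u,v):\{u,v\}\in\binom{V(H)}{2}\}$. The shadow-graph $H^{(2)}$ of a hypergraph $H$ is the graph on $V(H)$ in which $\{x,y\}$ is an edge if and only if some $e\in E(H)$ satisfies $\{x,y\}\subseteq e$. $H$ is connected if $H^{(2)}$ is connected, and the components of $H$ are its maximal connected subgraphs (so an isolated vertex is a component on one vertex). An $r$-coloring of $H$ is a partition $\{E_1,\dots,E_r\}$ of $E(H)$ in which some of the sets may be empty. A monochromatic component of $H$ (with respect to this coloring) is a component of the hypergraph $(V(H),E_i)$ for some $i\in\{1,\dots,r\}$. $\mathrm{mc}_r(H)$ is the largest integer $m$ such that in every $r$-coloring of the edges of $H$ there is a monochromatic component on at least $m$ vertices. $\alpha_3^*(H)$ is the maximum integer $a$ such that there exist pairwise disjoint sets $X_1,X_2,X_3\subseteq V(H)$ with $|X_1|=|X_2|=|X_3|=a$ such that for every $e\in E(H)$ there is $i\in\{1,2,3\}$ with $e\cap X_i=\emptyset$. -}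

module Defs where

open import Data.Fin using (Fin; _≟_)
open import Data.Fin.Patterns using (0F; 1F; 2F; 3F)
open import Data.Fin.Properties using (any?; all?)
open import Data.Fin.Subset using (Subset; _∈_; _⊆_; _∩_; ∣_∣; ⊤; Nonempty; Empty)
open import Data.Fin.Subset.Properties using (_∈?_; _⊆?_; nonempty?; anySubset?)
open import Data.List using (List; []; _∷_; allFin)
open import Data.List.Membership.Propositional using () renaming (_∈_ to _∈ˡ_)
open import Data.List.Membership.Propositional.Properties using (∈-allFin)
open import Data.List.Relation.Unary.Any using (here; there)
open import Data.Nat using (ℕ; zero; suc; _+_; _*_; _∸_; _≤_; _≥_; NonZero)
import Data.Nat.Properties as ℕ
open import Level using (0ℓ)
open import Data.Product using (∃; ∃-syntax; _×_; _,_; proj₁; proj₂)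
open import Data.Sum using (_⊎_; inj₁; inj₂)
open import Data.Vec using (Vec; []; _∷_; lookup; map; tabulate)
open import Function.Definitions using (Injective)
open import Relation.Binary using (Rel)
import Relation.Binary as B
open import Relation.Binary.Construct.Closure.ReflexiveTransitive using (Star; ε; _◅_; _◅◅_)
open import Relation.Binary.PropositionalEquality using (_≡_; _≢_; refl)
open import Relation.Nullary using (¬_; Dec; yes; no; does)
open import Relation.Nullary.Decidable using (map′; ¬?; _×-dec_; _→-dec_; _⊎-dec_; decidable-stable)
open import Relation.Unary using (Pred; Decidable)

-- The edges form a set of subsets of the vertex set; they are enumerated
-- without repetition by Fin size.
record Hypergraph (n : ℕ) : Set where
  field
    ⦃ nonZero ⦄ : NonZero n
    size        : ℕ
    edge        : Fin size → Subset n
    distinct    : Injective _≡_ _≡_ edge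

open Hypergraph public

module _ {n : ℕ} where

  Uniform : ℕ → Hypergraph n → Set
  Uniform k H = ∀ e → ∣ edge H e ∣ ≡ k

  codegree : Hypergraph n → Fin n → Fin n → ℕ
  codegree H u v = ∣ tabulate (λ e → does ((u ∈? edge H e) ×-dec (v ∈? edge H e))) ∣

  -- δ₂(H) ≥ k.  For n = 1 there are no pairs and the minimum over the empty
  -- set is taken to be ∞.
  δ₂[_]≥_ : Hypergraph n → ℕ → Set
  δ₂[ H ]≥ k = ∀ u v → u ≢ v → codegree H u v ≥ k

  -- A pair (vertex set, edge set) inside H; it is a hypergraph when it
  -- satisfies IsSubhypergraph.
  Sub : Hypergraph n → Set
  Sub H = Subset n × Subset (size H)

module _ {n : ℕ} (H : Hypergraph n) where

  IsSubhypergraph : Sub H → Set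
  IsSubhypergraph (W , F) = Nonempty W × (∀ e → e ∈ F → edge H e ⊆ W)

  _⊑_ : Sub H → Sub H → Set
  (W , F) ⊑ (W′ , F′) = W ⊆ W′ × F ⊆ F′

  Shadow : Sub H → Rel (Fin n) 0ℓ
  Shadow (W , F) x y = x ≢ y × ∃[ e ] (e ∈ F × x ∈ edge H e × y ∈ edge H e)

  Connected : Sub H → Set
  Connected K = ∀ x y → x ∈ proj₁ K → y ∈ proj₁ K → Star (Shadow K) x y

  IsComponent : Sub H → Sub H → Set
  IsComponent K C =
    IsSubhypergraph C × C ⊑ K × Connected C ×
    (∀ D → IsSubhypergraph D × D ⊑ K × Connected D → C ⊑ D → D ⊑ C)

  -- Entry e of the vector is the color of the e-th edge.
  Coloring : ℕ → Set
  Coloring r = Vec (Fin r) (size H)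

  colorClass : ∀ {r} → Coloring r → Fin r → Subset (size H)
  colorClass c i = map (λ j → does (j ≟ i)) c

  HasMonochromaticComponent≥ : ∀ {r} → ℕ → Coloring r → Set
  HasMonochromaticComponent≥ m c =
    ∃[ i ] ∃[ C ] (IsComponent (⊤ , colorClass c i) C × ∣ proj₁ C ∣ ≥ m)

  EveryColoringHas≥ : ℕ → ℕ → Set
  EveryColoringHas≥ r m = ∀ (c : Coloring r) → HasMonochromaticComponent≥ m c

  IsTransversalFree : Vec (Subset n) 3 → Set
  IsTransversalFree X =
    (∀ i j → i ≢ j → Empty (lookup X i ∩ lookup X j)) ×
    (∀ e → ∃[ i ] Empty (edge H e ∩ lookup X i))

  HasTransversalFreeTriple : ℕ → Set
  HasTransversalFreeTriple a =
    ∃[ X ] ((∀ i → ∣ lookup X i ∣ ≡ a) × IsTransversalFree X)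

-- The predicates above are decidable, so that the maxima below are functions.

any-Vec? : ∀ {A : Set} → (∀ {P : Pred A 0ℓ} → Decidable P → Dec (∃ P)) →
           ∀ {k} {P : Pred (Vec A k) 0ℓ} → Decidable P → Dec (∃ P)
any-Vec? any-A? {zero}  P? = map′ ([] ,_) (λ { ([] , p) → p }) (P? [])
any-Vec? any-A? {suc k} P? =
  map′ (λ (x , xs , p) → x ∷ xs , p) (λ { (x ∷ xs , p) → x , xs , p })
       (any-A? λ x → any-Vec? any-A? λ xs → P? (x ∷ xs))

all-from-any? : ∀ {A : Set} → (∀ {P : Pred A 0ℓ} → Decidable P → Dec (∃ P)) →
                ∀ {P : Pred A 0ℓ} → Decidable P → Dec (∀ x → P x)
all-from-any? any-A? P? =
  map′ (λ ¬∃¬ x → decidable-stable (P? x) (λ ¬p → ¬∃¬ (x , ¬p)))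
       (λ ∀p (x , ¬p) → ¬p (∀p x))
       (¬? (any-A? λ x → ¬? (P? x)))

-- Reachability, by recursion on the list of allowed intermediate vertices.
module Reachability {n : ℕ} (R : Rel (Fin n) 0ℓ) (R? : B.Decidable R) where

  Via : List (Fin n) → Rel (Fin n) 0ℓ
  Via []       x y = x ≡ y ⊎ R x y
  Via (w ∷ ws) x y = Via ws x y ⊎ (Via ws x w × Via ws w y)

  via? : ∀ ws → B.Decidable (Via ws)
  via? []       x y = (x ≟ y) ⊎-dec R? x y
  via? (w ∷ ws) x y = via? ws x y ⊎-dec (via? ws x w ×-dec via? ws w y)

  via⇒star : ∀ ws {x y} → Via ws x y → Star R x y
  via⇒star []       (inj₁ refl)    = ε
  via⇒star []       (inj₂ r)       = r ◅ ε
  via⇒star (w ∷ ws) (inj₁ p)       = via⇒star ws p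
  via⇒star (w ∷ ws) (inj₂ (p , q)) = via⇒star ws p ◅◅ via⇒star ws q

  weaken : ∀ ws {x y} → Via [] x y → Via ws x y
  weaken []       p = p
  weaken (w ∷ ws) p = inj₁ (weaken ws p)

  via-trans : ∀ ws {z x y} → z ∈ˡ ws → Via ws x z → Via ws z y → Via ws x y
  via-trans (w ∷ ws) (here refl) p q = inj₂ (to p , from q)
    where
    to : ∀ {x} → Via (w ∷ ws) x w → Via ws x w
    to (inj₁ p)       = p
    to (inj₂ (p , _)) = p
    from : ∀ {y} → Via (w ∷ ws) w y → Via ws w y
    from (inj₁ q)       = q
    from (inj₂ (_ , q)) = q
  via-trans (w ∷ ws) (there z∈) (inj₁ p)       (inj₁ q)        = inj₁ (via-trans ws z∈ p q)
  via-trans (w ∷ ws) (there z∈) (inj₁ p)       (inj₂ (q , q′)) = inj₂ (via-trans ws z∈ p q , q′)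
  via-trans (w ∷ ws) (there z∈) (inj₂ (p , p′)) (inj₁ q)       = inj₂ (p , via-trans ws z∈ p′ q)
  via-trans (w ∷ ws) (there z∈) (inj₂ (p , _)) (inj₂ (_ , q′)) = inj₂ (p , q′)

  star⇒via : ∀ {x y} → Star R x y → Via (allFin n) x y
  star⇒via ε        = weaken (allFin n) (inj₁ refl)
  star⇒via (r ◅ rs) =
    via-trans (allFin n) (∈-allFin _) (weaken (allFin n) (inj₂ r)) (star⇒via rs)

  star? : B.Decidable (Star R)
  star? x y = map′ (via⇒star (allFin n)) star⇒via (via? (allFin n) x y)

module _ {n : ℕ} (H : Hypergraph n) where

  any-Sub? : ∀ {P : Pred (Sub H) 0ℓ} → Decidable P → Dec (∃ P)
  any-Sub? P? =
    map′ (λ (W , F , p) → (W , F) , p) (λ ((W , F) , p) → W , F , p)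
         (anySubset? λ W → anySubset? λ F → P? (W , F))

  isSubhypergraph? : Decidable (IsSubhypergraph H)
  isSubhypergraph? (W , F) =
    nonempty? W ×-dec all? λ e → (e ∈? F) →-dec (edge H e ⊆? W)

  ⊑? : B.Decidable (_⊑_ H)
  ⊑? (W , F) (W′ , F′) = (W ⊆? W′) ×-dec (F ⊆? F′)

  shadow? : ∀ K → B.Decidable (Shadow H K)
  shadow? (W , F) x y =
    ¬? (x ≟ y) ×-dec
    any? λ e → (e ∈? F) ×-dec ((x ∈? edge H e) ×-dec (y ∈? edge H e))

  connected? : Decidable (Connected H)
  connected? K = all? λ x → all? λ y →
    (x ∈? proj₁ K) →-dec ((y ∈? proj₁ K) →-dec star? x y)
    where open Reachability (Shadow H K) (shadow? K)

  isComponent? : B.Decidable (IsComponent H)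
  isComponent? K C =
    isSubhypergraph? C ×-dec (⊑? C K ×-dec (connected? C ×-dec
    all-from-any? any-Sub? λ D →
      (isSubhypergraph? D ×-dec (⊑? D K ×-dec connected? D)) →-dec (⊑? C D →-dec ⊑? D C)))

  hasMonochromaticComponent≥? : ∀ {r} m → Decidable (HasMonochromaticComponent≥ H {r} m)
  hasMonochromaticComponent≥? m c =
    any? λ i → any-Sub? λ C →
      isComponent? (⊤ , colorClass H c i) C ×-dec (m ℕ.≤? ∣ proj₁ C ∣)

  everyColoringHas≥? : ∀ r → Decidable (EveryColoringHas≥ H r)
  everyColoringHas≥? r m =
    all-from-any? (any-Vec? any?) (hasMonochromaticComponent≥? m)

  hasTransversalFreeTriple? : Decidable (HasTransversalFreeTriple H)
  hasTransversalFreeTriple? a = any-Vec? anySubset? λ X →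
    (all? λ i → ∣ lookup X i ∣ ℕ.≟ a) ×-dec
    ((all? λ i → all? λ j → ¬? (i ≟ j) →-dec ¬? (nonempty? (lookup X i ∩ lookup X j))) ×-dec
     (all? λ e → any? λ i → ¬? (nonempty? (edge H e ∩ lookup X i))))

-- The largest m ≤ b satisfying P, provided there is one (and 0 otherwise).
greatest : ∀ {P : Pred ℕ 0ℓ} → Decidable P → ℕ → ℕ
greatest P? zero    = zero
greatest P? (suc b) with P? (suc b)
... | yes _ = suc b
... | no  _ = greatest P? b

-- In both maxima the bound n loses nothing: the sizes involved are sizes of
-- subsets of the vertex set, and 0 always qualifies (for mc, when r ≥ 1).

mc : ∀ {n} (r : ℕ) → .⦃ NonZero r ⦄ → Hypergraph n → ℕ
mc {n} r H = greatest (everyColoringHas≥? H r) n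

α₃* : ∀ {n} → Hypergraph n → ℕ
α₃* {n} H = greatest (hasTransversalFreeTriple? H) n

module _ {n : ℕ} where

  record IsPartition {k} (V : Fin k → Subset n) : Set where
    field
      nonempty : ∀ i → Nonempty (V i)
      disjoint : ∀ i j → i ≢ j → Empty (V i ∩ V j)
      cover    : ∀ x → ∃[ i ] (x ∈ V i)

  Meets : (H : Hypergraph n) → Fin (size H) → Subset n → Set
  Meets H e X = Nonempty (edge H e ∩ X)

pattern blue  = 0F
pattern red   = 1F
pattern green = 2F

-- The parts V₁, V₂, V₃, V₄ are V 0F, V 1F, V 2F, V 3F.
record FourPartStructure {n : ℕ} (H : Hypergraph n) : Set where
  field
    coloring    : Coloring H 3
    V           : Fin 4 → Subset n
    isPartition : IsPartition V

  AllCrossing : Fin 4 → Fin 4 → Fin 3 → Set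
  AllCrossing i j color =
    ∀ e → Meets H e (V i) → Meets H e (V j) → lookup coloring e ≡ color

  field
    V₁≥V₂ : ∣ V 0F ∣ ≥ ∣ V 1F ∣
    V₂≥V₃ : ∣ V 1F ∣ ≥ ∣ V 2F ∣
    V₃≥V₄ : ∣ V 2F ∣ ≥ ∣ V 3F ∣
    α≥V₂  : α₃* H ≥ ∣ V 1F ∣
    V₁+Vᵢ : ∀ i → i ≢ 0F → ∣ V 0F ∣ + ∣ V i ∣ ≥ n ∸ 2 * α₃* H

    noThreeParts : ∀ e i j k → i ≢ j → i ≢ k → j ≢ k →
                   ¬ (Meets H e (V i) × Meets H e (V j) × Meets H e (V k))

    blue₁₂  : AllCrossing 0F 1F blue
    blue₃₄  : AllCrossing 2F 3F blue
    red₁₃   : AllCrossing 0F 2F red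
    red₂₄   : AllCrossing 1F 3F red
    green₁₄ : AllCrossing 0F 3F green
    green₂₃ : AllCrossing 1F 2F green

{-# OPTIONS --safe #-}

-- Fix a 3-coloring, and label each vertex by its triple of monochromatic
-- components.  Since every pair lies in an edge, any two labels agree in some
-- coordinate: the labels form an intersecting 3-partite family.  If no
-- component spans, some two labels agree in exactly one coordinate, and a
-- short analysis leaves two possibilities.
--  * There are components B, R, G, one per color, such that every vertex is in
--    at least two of them.  Their complements are then disjoint, and no edge
--    meets all three, so one of them has size at most α₃*.
--  * Only the labels 000, 011, 101, 110 occur.  They give the parts Vᵢ.  If two
--    parts were larger than α₃*, then these two parts and the complement of the
--    component containing both would contradict the definition of α₃*, unless
--    that component has at least n − α₃* vertices.

module Submission where

open import Defs
open import Data.Bool using (if_then_else_)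
open import Data.Empty using (⊥-elim)
open import Data.Fin as Fin using (Fin; zero; suc; punchIn; _≟_)
open import Data.Fin.Patterns using (0F; 1F; 2F; 3F)
open import Data.Fin.Permutation
  using (Permutation; Permutation′; _⟨$⟩ʳ_; _⟨$⟩ˡ_; inverseʳ; insert; transpose; id)
open import Data.Fin.Properties using (all?; any?; punchInᵢ≢i; 0≢1+n)
open import Data.Fin.Subset using (Subset; inside; outside; _∈_; _∉_; _⊆_; _∩_; _∪_; ∁; ∣_∣; ⊤; Nonempty; Empty)
  renaming (⊥ to ∅)
open import Data.Fin.Subset.Properties
open import Data.List using (allFin)
open import Data.List.Membership.Propositional.Properties using (∈-allFin)
import Data.List.Relation.Unary.All as All
open import Data.Nat using (ℕ; zero; suc; _+_; _*_; _∸_; _≤_; _<_; _≥_; z≤n; s≤s; NonZero)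
import Data.Nat.Properties as ℕ
open import Data.List.Extrema ℕ.≤-totalOrder using (argmax; f[xs]≤f[argmax])
open import Data.Product using (∃; ∃-syntax; _×_; _,_; proj₁; proj₂) renaming (map₁ to map₁×; map₂ to map₂×)
open import Data.Sum using (_⊎_; inj₁; inj₂; [_,_]′; map; map₁; map₂)
open import Data.Vec using (Vec; []; _∷_; lookup; tabulate)
open import Data.Vec.Properties using ([]=⇒lookup; lookup⇒[]=; lookup∘tabulate; lookup-map)
open import Function using (_∘_; case_of_)
open import Function.Bundles using (Injection)
open import Function.Properties.Inverse using (↔⇒↣)
open import Level using (0ℓ)
open import Relation.Binary using (Rel; IsDecEquivalence)
open import Relation.Binary.Construct.Closure.ReflexiveTransitive using (Star; ε; _◅_; _◅◅_; reverse)
import Relation.Binary.Construct.Closure.ReflexiveTransitive as Star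
open import Relation.Binary.PropositionalEquality using (_≡_; _≢_; refl; sym; trans; cong; subst; ≢-sym)
open import Relation.Nullary using (¬_; Dec; yes; no; does; contradiction)
open import Relation.Nullary.Decidable using (dec-true; dec-false; decidable-stable; from-yes; toWitness; ¬?; _→-dec_; _×-dec_)
open import Relation.Unary using (Pred; Decidable)

-- Finite subsets, greatest elements and sorting.

module _ {n : ℕ} {P : Pred (Fin n) 0ℓ} (P? : Decidable P) where

  comprehension : Subset n
  comprehension = tabulate (does ∘ P?)

  ∈-comprehension⁺ : ∀ {x} → P x → x ∈ comprehension
  ∈-comprehension⁺ {x} px = lookup⇒[]= x _ (trans (lookup∘tabulate _ x) (dec-true (P? x) px))

  ∈-comprehension⁻ : ∀ {x} → x ∈ comprehension → P x
  ∈-comprehension⁻ {x} x∈ with P? x | trans (sym (lookup∘tabulate (does ∘ P?) x)) ([]=⇒lookup x∈)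
  ... | yes px | _  = px
  ... | no  _  | ()

∣p∣>0⇒nonempty : ∀ {n} (p : Subset n) → 0 < ∣ p ∣ → Nonempty p
∣p∣>0⇒nonempty {n} p 0<∣p∣ with nonempty? p
... | yes ne    = ne
... | no  empty =
  contradiction (trans (cong ∣_∣ (Empty-unique empty)) (∣⊥∣≡0 n)) (ℕ.>⇒≢ 0<∣p∣)

∣p∪q∣≤∣p∣+∣q∣ : ∀ {n} (p q : Subset n) → ∣ p ∪ q ∣ ≤ ∣ p ∣ + ∣ q ∣
∣p∪q∣≤∣p∣+∣q∣ []            []            = z≤n
∣p∪q∣≤∣p∣+∣q∣ (inside  ∷ p) (inside  ∷ q) =
  s≤s (ℕ.≤-trans (∣p∪q∣≤∣p∣+∣q∣ p q) (ℕ.+-monoʳ-≤ ∣ p ∣ (ℕ.n≤1+n ∣ q ∣)))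
∣p∪q∣≤∣p∣+∣q∣ (inside  ∷ p) (outside ∷ q) = s≤s (∣p∪q∣≤∣p∣+∣q∣ p q)
∣p∪q∣≤∣p∣+∣q∣ (outside ∷ p) (inside  ∷ q) =
  ℕ.≤-trans (s≤s (∣p∪q∣≤∣p∣+∣q∣ p q)) (ℕ.≤-reflexive (sym (ℕ.+-suc ∣ p ∣ ∣ q ∣)))
∣p∪q∣≤∣p∣+∣q∣ (outside ∷ p) (outside ∷ q) = ∣p∪q∣≤∣p∣+∣q∣ p q

subset-of-size : ∀ {n} (p : Subset n) k → k ≤ ∣ p ∣ → ∃[ q ] (q ⊆ p × ∣ q ∣ ≡ k)
subset-of-size {n} p  zero    _          = ∅ , (λ x∈∅ → contradiction x∈∅ ∉⊥) , ∣⊥∣≡0 n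
subset-of-size (inside ∷ p)  (suc k) (s≤s k≤) with subset-of-size p k k≤
... | q , q⊆p , ∣q∣≡k = inside ∷ q , s⊆s q⊆p , cong suc ∣q∣≡k
subset-of-size (outside ∷ p) (suc k) k≤       with subset-of-size p (suc k) k≤
... | q , q⊆p , ∣q∣≡k = outside ∷ q , s⊆s q⊆p , ∣q∣≡k

greatest-upper : ∀ {P : Pred ℕ 0ℓ} (P? : Decidable P) b {m} → P m → m ≤ b → m ≤ greatest P? b
greatest-upper P? zero    pm m≤b = m≤b
greatest-upper P? (suc b) pm m≤b with P? (suc b)
... | yes _  = m≤b
... | no  ¬p with ℕ.m≤n⇒m<n∨m≡n m≤b
...   | inj₁ (s≤s m≤b′) = greatest-upper P? b pm m≤b′
...   | inj₂ refl       = contradiction pm ¬p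

Descending : ∀ {n} → (Fin n → ℕ) → Set
Descending f = ∀ {i j} → i Fin.≤ j → f i ≥ f j

abstract

  maximum : ∀ {n} (f : Fin (suc n) → ℕ) → ∃[ top ] (∀ i → f i ≤ f top)
  maximum f = argmax f zero (allFin _) , λ i → All.lookup (f[xs]≤f[argmax] {f = f} zero (allFin _)) (∈-allFin i)

  -- Selection sort: `insert zero top` puts an index of maximal value first, and the recursion
  -- orders the remaining indices through `punchIn`.
  sorting : ∀ {n} (f : Fin n → ℕ) → ∃ λ (τ : Permutation′ n) → Descending (λ i → f (τ ⟨$⟩ʳ i))
  sorting {zero}  f = id , λ { {()} }
  sorting {suc n} f = insert zero top τ , descending
    where
    top : Fin (suc n)
    top = proj₁ (maximum f)

    τ : Permutation′ n
    τ = proj₁ (sorting (f ∘ punchIn top))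

    descending : Descending (λ i → f (insert zero top τ ⟨$⟩ʳ i))
    descending {zero}  {j}     _         = proj₂ (maximum f) (insert zero top τ ⟨$⟩ʳ j)
    descending {suc i} {suc j} (s≤s i≤j) = proj₂ (sorting (f ∘ punchIn top)) {i} {j} i≤j

-- Maximality of `α₃*` as a bound.

module _ {n : ℕ} (H : Hypergraph n) where

  -- Maximality in the definition of `α₃*`, detached from the search that computes it: the counting
  -- below uses only this property of `a`.
  record TransversalFreeBound (a : ℕ) : Set where
    field
      size≤ : ∀ k (X : Fin 3 → Subset n) → (∀ i → k ≤ ∣ X i ∣) →
              (∀ {i j} → i ≢ j → ∀ {x} → x ∈ X i → x ∉ X j) →
              (∀ e → ∃[ i ] (∀ {x} → x ∈ edge H e → x ∉ X i)) →
              k ≤ a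

  -- Cutting each set down to exactly `k` vertices keeps the triple disjoint and transversal-free,
  -- and `k` is within the search range since a subset has at most `n` elements.
  α₃*-bound : TransversalFreeBound (α₃* H)
  α₃*-bound .TransversalFreeBound.size≤ k X k≤ disjoint free =
    greatest-upper (hasTransversalFreeTriple? H) n
      (tabulate Y , size≡ , disjoint′ , free′)
      (ℕ.≤-trans (k≤ 0F) (∣p∣≤n (X 0F)))
    where
    Y : Fin 3 → Subset n
    Y i = proj₁ (subset-of-size (X i) k (k≤ i))

    Y⊆X : ∀ i {x} → x ∈ lookup (tabulate Y) i → x ∈ X i
    Y⊆X i x∈ = proj₁ (proj₂ (subset-of-size (X i) k (k≤ i)))
                 (subst (_ ∈_) (lookup∘tabulate Y i) x∈)

    size≡ : ∀ i → ∣ lookup (tabulate Y) i ∣ ≡ k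
    size≡ i = trans (cong ∣_∣ (lookup∘tabulate Y i)) (proj₂ (proj₂ (subset-of-size (X i) k (k≤ i))))

    disjoint′ : ∀ i j → i ≢ j → Empty (lookup (tabulate Y) i ∩ lookup (tabulate Y) j)
    disjoint′ i j i≢j (x , x∈) with x∈p∩q⁻ _ _ x∈
    ... | x∈i , x∈j = disjoint i≢j (Y⊆X i x∈i) (Y⊆X j x∈j)

    free′ : ∀ e → ∃[ i ] Empty (edge H e ∩ lookup (tabulate Y) i)
    free′ e with free e
    ... | i , e∩X=∅ = i , λ (x , x∈) → let x∈e , x∈Y = x∈p∩q⁻ _ _ x∈ in e∩X=∅ x∈e (Y⊆X i x∈Y)

-- Monochromatic components as reachability classes.

module _ {n : ℕ} (H : Hypergraph n) {r : ℕ} (c : Coloring H r) where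

  ∈-colorClass⁺ : ∀ {i e} → lookup c e ≡ i → e ∈ colorClass H c i
  ∈-colorClass⁺ {i} {e} ce≡i =
    lookup⇒[]= e _ (trans (lookup-map e _ c) (dec-true (lookup c e ≟ i) ce≡i))

  ∈-colorClass⁻ : ∀ {i e} → e ∈ colorClass H c i → lookup c e ≡ i
  ∈-colorClass⁻ {i} {e} e∈ with lookup c e ≟ i | trans (sym (lookup-map e (λ j → does (j ≟ i)) c)) ([]=⇒lookup e∈)
  ... | yes p | _  = p
  ... | no  _ | ()

  module _ (i : Fin r) where

    private
      K : Sub H
      K = ⊤ , colorClass H c i

    Joined : Rel (Fin n) 0ℓ
    Joined = Star (Shadow H K)

    joined? : ∀ x y → Dec (Joined x y)
    joined? = Reachability.star? (Shadow H K) (shadow? H K)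

    edge-joined : ∀ {e} → lookup c e ≡ i → ∀ {x y} → x ∈ edge H e → y ∈ edge H e → Joined x y
    edge-joined {e} ce≡i {x} {y} x∈e y∈e with x ≟ y
    ... | yes refl = ε
    ... | no  x≢y  = (x≢y , e , ∈-colorClass⁺ ce≡i , x∈e , y∈e) ◅ ε

    joined-isDecEquivalence : IsDecEquivalence Joined
    joined-isDecEquivalence = record
      { isEquivalence = record
        { refl  = ε
        ; sym   = reverse λ (x≢y , e , e∈ , x∈e , y∈e) → ≢-sym x≢y , e , e∈ , y∈e , x∈e
        ; trans = _◅◅_
        }
      ; _≟_ = joined?
      }

    edgeWithin? : ∀ W → Decidable λ e → e ∈ colorClass H c i × edge H e ⊆ W
    edgeWithin? W e = (e ∈? colorClass H c i) ×-dec (edge H e ⊆? W)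

    module _ (x : Fin n) where

      private
        W : Subset n
        W = comprehension (joined? x)

        F : Subset (size H)
        F = comprehension (edgeWithin? W)

        ∈W⁺ : ∀ {y} → Joined x y → y ∈ W
        ∈W⁺ = ∈-comprehension⁺ (joined? x)

        ∈W⁻ : ∀ {y} → y ∈ W → Joined x y
        ∈W⁻ = ∈-comprehension⁻ (joined? x)

        ∈F⁺ : ∀ {e} → e ∈ colorClass H c i → edge H e ⊆ W → e ∈ F
        ∈F⁺ e∈ e⊆W = ∈-comprehension⁺ (edgeWithin? W) (e∈ , e⊆W)

        ∈F⁻ : ∀ {e} → e ∈ F → e ∈ colorClass H c i × edge H e ⊆ W
        ∈F⁻ = ∈-comprehension⁻ (edgeWithin? W)

      -- A path from `x` never leaves its class `W`, so its edges all lie in `F`; conversely, a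
      -- connected subhypergraph of that color containing `x` has only vertices joined to `x`.
      component : IsComponent H K (W , F)
      component =
        ((x , ∈W⁺ ε) , λ e → proj₂ ∘ ∈F⁻) ,
        (⊆⊤ , proj₁ ∘ ∈F⁻) ,
        (λ y z y∈ z∈ → reverse shadow-sym (restrict ε (∈W⁻ y∈)) ◅◅ restrict ε (∈W⁻ z∈)) ,
        maximal
        where
        shadow-sym : ∀ {y z} → Shadow H (W , F) y z → Shadow H (W , F) z y
        shadow-sym (y≢z , e , e∈ , y∈e , z∈e) = ≢-sym y≢z , e , e∈ , z∈e , y∈e

        -- The first argument carries along how the current vertex was reached from `x`; this places
        -- the next edge inside `W`.
        restrict : ∀ {y z} → Joined x y → Joined y z → Star (Shadow H (W , F)) y z
        restrict xy ε = ε
        restrict xy (s@(y≢z , e , e∈ , y∈e , z∈e) ◅ zs) =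
          (y≢z , e , ∈F⁺ e∈ (λ w∈e → ∈W⁺ (xy ◅◅ edge-joined (∈-colorClass⁻ e∈) y∈e w∈e)) , y∈e , z∈e)
          ◅ restrict (xy ◅◅ s ◅ ε) zs

        maximal : ∀ D → IsSubhypergraph H D × _⊑_ H D K × Connected H D →
                  _⊑_ H (W , F) D → _⊑_ H D (W , F)
        maximal (W′ , F′) ((_ , closed) , (_ , F′⊆) , connected) (W⊆W′ , _) =
          W′⊆W , λ {e} e∈ → ∈F⁺ (F′⊆ e∈) (λ y∈e → W′⊆W (closed e e∈ y∈e))
          where
          W′⊆W : W′ ⊆ W
          W′⊆W {y} y∈ = ∈W⁺ (Star.map (λ (y≢z , e , e∈ , y∈z∈) → y≢z , e , F′⊆ e∈ , y∈z∈)
                               (connected x y (W⊆W′ (∈W⁺ ε)) y∈))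

-- Permutations, three colors and covers.

⟨$⟩ʳ-injective : ∀ {m n} (π : Permutation m n) {i j} → π ⟨$⟩ʳ i ≡ π ⟨$⟩ʳ j → i ≡ j
⟨$⟩ʳ-injective π = Injection.injective (↔⇒↣ π)

third : ∀ (a b c d : Fin 3) → a ≢ b → a ≢ c → b ≢ c → d ≢ b → d ≢ c → d ≡ a
third = toWitness {a? = decision} _
  where
  decision : Dec (∀ (a b c d : Fin 3) → a ≢ b → a ≢ c → b ≢ c → d ≢ b → d ≢ c → d ≡ a)
  decision = all? λ a → all? λ b → all? λ c → all? λ d →
    ¬? (a ≟ b) →-dec (¬? (a ≟ c) →-dec (¬? (b ≟ c) →-dec (¬? (d ≟ b) →-dec (¬? (d ≟ c) →-dec (d ≟ a)))))

remainder-large : ∀ {n a} (p q r : Subset n) → ∣ q ∣ ≤ a → ∣ r ∣ ≤ a →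
                  (∀ x → x ∈ p ⊎ x ∈ q ⊎ x ∈ r) → n ∸ 2 * a ≤ ∣ p ∣
remainder-large {n} {a} p q r q≤a r≤a cover = ℕ.m≤n+o⇒m∸n≤o n (2 * a) (begin
  n                              ≡⟨ ∣⊤∣≡n n ⟨
  ∣ ⊤ {n} ∣                      ≤⟨ p⊆q⇒∣p∣≤∣q∣ {p = ⊤ {n}} (λ {x} _ → inUnion (cover x)) ⟩
  ∣ (q ∪ r) ∪ p ∣                ≤⟨ ∣p∪q∣≤∣p∣+∣q∣ (q ∪ r) p ⟩
  ∣ q ∪ r ∣ + ∣ p ∣              ≤⟨ ℕ.+-monoˡ-≤ ∣ p ∣ (∣p∪q∣≤∣p∣+∣q∣ q r) ⟩
  ∣ q ∣ + ∣ r ∣ + ∣ p ∣          ≤⟨ ℕ.+-monoˡ-≤ ∣ p ∣ (ℕ.+-mono-≤ q≤a (ℕ.≤-trans r≤a (ℕ.m≤m+n a 0))) ⟩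
  2 * a + ∣ p ∣                  ∎)
  where
  open ℕ.≤-Reasoning
  inUnion : ∀ {x} → x ∈ p ⊎ x ∈ q ⊎ x ∈ r → x ∈ (q ∪ r) ∪ p
  inUnion (inj₁ x∈p)        = x∈p∪q⁺ {p = q ∪ r} (inj₂ x∈p)
  inUnion (inj₂ (inj₁ x∈q)) = x∈p∪q⁺ (inj₁ (x∈p∪q⁺ (inj₁ x∈q)))
  inUnion (inj₂ (inj₂ x∈r)) = x∈p∪q⁺ (inj₁ (x∈p∪q⁺ {p = q} (inj₂ x∈r)))

-- A coloring of H seen through the relations R c, "joined by a path of color c".
-- Unlike the colorings themselves, these data can be relabelled by permuting
-- the colors without touching H.
record ColorSystem {n : ℕ} (H : Hypergraph n) : Set₁ where
  field
    R                : Fin 3 → Rel (Fin n) 0ℓ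
    isDecEquivalence : ∀ c → IsDecEquivalence (R c)
    meet             : ∀ x y → ∃[ c ] R c x y
    color            : Fin (size H) → Fin 3
    mono             : ∀ {e x y} → x ∈ edge H e → y ∈ edge H e → R (color e) x y

  module _ {c : Fin 3} where
    open IsDecEquivalence (isDecEquivalence c) public
      using () renaming (refl to R-refl; sym to R-sym; trans to R-trans)

  R? : ∀ c x y → Dec (R c x y)
  R? c = IsDecEquivalence._≟_ (isDecEquivalence c)

  class : Fin 3 → Fin n → Subset n
  class c x = comprehension (R? c x)

  ∈-class⁺ : ∀ {c x y} → R c x y → y ∈ class c x
  ∈-class⁺ = ∈-comprehension⁺ (R? _ _)

  ∈-class⁻ : ∀ {c x y} → y ∈ class c x → R c x y
  ∈-class⁻ = ∈-comprehension⁻ (R? _ _)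

  ∉-class : ∀ {c x y} → y ∈ ∁ (class c x) → ¬ R c x y
  ∉-class y∉ = x∈∁p⇒x∉p y∉ ∘ ∈-class⁺

  ∁class⁺ : ∀ {c x y} → ¬ R c x y → y ∈ ∁ (class c x)
  ∁class⁺ ¬xy = x∉p⇒x∈∁p (¬xy ∘ ∈-class⁻)

relabel : ∀ {n} {H : Hypergraph n} → Permutation′ 3 → ColorSystem H → ColorSystem H
relabel σ S = record
  { R                = λ c → R (σ ⟨$⟩ʳ c)
  ; isDecEquivalence = λ c → isDecEquivalence (σ ⟨$⟩ʳ c)
  ; meet             = λ x y → let c , xy = meet x y in
                         σ ⟨$⟩ˡ c , subst (λ d → R d x y) (sym (inverseʳ σ)) xy
  ; color            = λ e → σ ⟨$⟩ˡ color e
  ; mono             = λ x∈e y∈e → subst (λ d → R d _ _) (sym (inverseʳ σ)) (mono x∈e y∈e)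
  }
  where open ColorSystem S

-- Labels agreeing in one color, and the two outcomes.

module _ {n : ℕ} {H : Hypergraph n} (S : ColorSystem H) where
  open ColorSystem S

  OnlyColor : Fin 3 → Rel (Fin n) 0ℓ
  OnlyColor i x y = R i x y × (∀ {c} → R c x y → c ≡ i)

  onlyColor-sym : ∀ {i x y} → OnlyColor i x y → OnlyColor i y x
  onlyColor-sym (xy , only) = R-sym xy , only ∘ R-sym

  -- χ is the proper edge coloring of K₄ on the points v, kept abstract so that
  -- the points can be reordered by size.
  record FourPoints : Set where
    field
      v      : Fin 4 → Fin n
      χ      : Fin 4 → Fin 4 → Fin 3
      only   : ∀ l m → l ≢ m → OnlyColor (χ l m) (v l) (v m)
      proper : ∀ l m k → l ≢ m → l ≢ k → m ≢ k → χ l m ≢ χ l k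
      cover  : ∀ x → ∃[ l ] (∀ c → R c (v l) x)

  -- The components B, R, G are the classes of `rep d` in color `d`; the witness `c` is the one
  -- color in which `y` may fall outside.
  TwoOfThree : Set
  TwoOfThree = ∃ λ (rep : Fin 3 → Fin n) → (∀ y → ∃[ c ] (∀ d → d ≢ c → R d (rep d) y))

  reorder : Permutation′ 4 → FourPoints → FourPoints
  reorder τ F = record
    { v      = v ∘ t
    ; χ      = λ l m → χ (t l) (t m)
    ; only   = λ l m l≢m → only (t l) (t m) (l≢m ∘ ⟨$⟩ʳ-injective τ)
    ; proper = λ l m k l≢m l≢k m≢k → proper (t l) (t m) (t k)
                 (l≢m ∘ ⟨$⟩ʳ-injective τ) (l≢k ∘ ⟨$⟩ʳ-injective τ) (m≢k ∘ ⟨$⟩ʳ-injective τ)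
    ; cover  = λ x → let l , lx = cover x in
                 τ ⟨$⟩ˡ l , λ c → subst (λ m → R c (v m) x) (sym (inverseʳ τ)) (lx c)
    }
    where
    open FourPoints F
    t = τ ⟨$⟩ʳ_

  meet₃ : ∀ x y → R 0F x y ⊎ R 1F x y ⊎ R 2F x y
  meet₃ x y with meet x y
  ... | 0F , xy = inj₁ xy
  ... | 1F , xy = inj₂ (inj₁ xy)
  ... | 2F , xy = inj₂ (inj₂ xy)

  only₀ : ∀ {x y} → ¬ R 1F x y → ¬ R 2F x y → OnlyColor 0F x y
  only₀ {x} {y} ¬1 ¬2 = [ (λ r → r) , [ ⊥-elim ∘ ¬1 , ⊥-elim ∘ ¬2 ]′ ]′ (meet₃ x y) ,
    λ { {0F} _ → refl ; {1F} r → ⊥-elim (¬1 r) ; {2F} r → ⊥-elim (¬2 r) }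

  only₁ : ∀ {x y} → ¬ R 0F x y → ¬ R 2F x y → OnlyColor 1F x y
  only₁ {x} {y} ¬0 ¬2 = [ ⊥-elim ∘ ¬0 , [ (λ r → r) , ⊥-elim ∘ ¬2 ]′ ]′ (meet₃ x y) ,
    λ { {0F} r → ⊥-elim (¬0 r) ; {1F} _ → refl ; {2F} r → ⊥-elim (¬2 r) }

  only₂ : ∀ {x y} → ¬ R 0F x y → ¬ R 1F x y → OnlyColor 2F x y
  only₂ {x} {y} ¬0 ¬1 = [ ⊥-elim ∘ ¬0 , [ ⊥-elim ∘ ¬1 , (λ r → r) ]′ ]′ (meet₃ x y) ,
    λ { {0F} r → ⊥-elim (¬0 r) ; {1F} r → ⊥-elim (¬1 r) ; {2F} _ → refl }

  -- Give `u` the label 000. Take `w` outside its 0-class and `x` outside its 1-class. Either one of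
  -- them agrees with `u` in one color only, or they have labels ∗00 and 0∗0 with ∗ ≠ 0 and agree
  -- with each other in color 2 only.
  onlyColor-pair : (∀ c x → ∃[ y ] ¬ R c x y) → Fin n → ∃[ i ] ∃[ x ] ∃[ y ] OnlyColor i x y
  onlyColor-pair nonspanning u with nonspanning 0F u
  ... | w , ¬0uw with R? 1F u w | R? 2F u w
  ...   | no ¬1uw | _       = 2F , u , w , only₂ ¬0uw ¬1uw
  ...   | yes 1uw | no ¬2uw = 1F , u , w , only₁ ¬0uw ¬2uw
  ...   | yes 1uw | yes 2uw with nonspanning 1F u
  ...     | x , ¬1ux with R? 0F u x | R? 2F u x
  ...       | no ¬0ux | _       = 2F , u , x , only₂ ¬0ux ¬1ux
  ...       | yes 0ux | no ¬2ux = 0F , u , x , only₀ ¬1ux ¬2ux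
  ...       | yes 0ux | yes 2ux = 2F , w , x , only₂ (λ 0wx → ¬0uw (R-trans 0ux (R-sym 0wx)))
                                                     (λ 1wx → ¬1ux (R-trans 1uw 1wx))

  -- If u and v agree only in color 0, normalise their labels to 000 and 011;
  -- then Cross u v holds of labels ∗01, and Cross v u of labels ∗10, with ∗ ≠ 0.
  Cross : Fin n → Fin n → Pred (Fin n) 0ℓ
  Cross u v w = ¬ R 0F u w × R 1F u w × R 2F v w

  cross? : ∀ u v → Decidable (Cross u v)
  cross? u v w = ¬? (R? 0F u w) ×-dec (R? 1F u w ×-dec R? 2F v w)

  module _ {u v : Fin n} (uv : OnlyColor 0F u v) where

    ¬1uv : ¬ R 1F u v
    ¬1uv r = case proj₂ uv r of λ ()

    ¬2uv : ¬ R 2F u v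
    ¬2uv r = case proj₂ uv r of λ ()

    -- `w` is joined to each of `u` and `v` in color 1 or 2, and not to both in the same color,
    -- because `u` and `v` differ in these two.
    outside-crosses : ∀ {w} → ¬ R 0F u w → Cross u v w ⊎ Cross v u w
    outside-crosses {w} ¬0uw with meet₃ u w | meet₃ v w
    ... | inj₁ 0uw        | _               = contradiction 0uw ¬0uw
    ... | inj₂ _          | inj₁ 0vw        = contradiction (R-trans (proj₁ uv) 0vw) ¬0uw
    ... | inj₂ (inj₁ 1uw) | inj₂ (inj₁ 1vw) = contradiction (R-trans 1uw (R-sym 1vw)) ¬1uv
    ... | inj₂ (inj₁ 1uw) | inj₂ (inj₂ 2vw) = inj₁ (¬0uw , 1uw , 2vw)
    ... | inj₂ (inj₂ 2uw) | inj₂ (inj₁ 1vw) = inj₂ (¬0uw ∘ R-trans (proj₁ uv) , 1vw , 2uw)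
    ... | inj₂ (inj₂ 2uw) | inj₂ (inj₂ 2vw) = contradiction (R-trans 2uw (R-sym 2vw)) ¬2uv

    -- The three classes carry the labels 0, 0, 1. Inside the 0-class of `u`, a vertex must agree
    -- with `w`, labelled ∗01, in color 1 or 2; outside it, only `Cross u v` is left.
    twoOfThree : ∀ {w} → Cross u v w → (∀ x → ¬ Cross v u x) → TwoOfThree
    twoOfThree {w} (¬0uw , 1uw , 2vw) none = rep , near
      where
      rep : Fin 3 → Fin n
      rep 0F = u
      rep 1F = u
      rep 2F = v

      near : ∀ y → ∃[ c ] (∀ d → d ≢ c → R d (rep d) y)
      near y with R? 0F u y
      near y | no ¬0uy with outside-crosses ¬0uy
      ... | inj₂ vu              = contradiction vu (none y)
      ... | inj₁ (_ , 1uy , 2vy) = 0F , λ { 0F d≢ → contradiction refl d≢ ; 1F _ → 1uy ; 2F _ → 2vy }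
      near y | yes 0uy with meet₃ w y
      ... | inj₁ 0wy        = contradiction (R-trans 0uy (R-sym 0wy)) ¬0uw
      ... | inj₂ (inj₁ 1wy) =
        2F , λ { 0F _ → 0uy ; 1F _ → R-trans 1uw 1wy ; 2F d≢ → contradiction refl d≢ }
      ... | inj₂ (inj₂ 2wy) =
        1F , λ { 0F _ → 0uy ; 1F d≢ → contradiction refl d≢ ; 2F _ → R-trans 2vw 2wy }

    -- `w` and `w′` have labels ∗01 and ∗10, so they can agree only in color 0; the four labels are
    -- then 000, 011, 101, 110.
    fourPoints : ∀ {w w′} → Cross u v w → Cross v u w′ → FourPoints
    fourPoints {w} {w′} (¬0uw , 1uw , 2vw) (¬0vw′ , 1vw′ , 2uw′) = record
      { v      = pt
      ; χ      = χ
      ; only   = only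
      ; proper = from-yes (all? λ l → all? λ m → all? λ k →
                   ¬? (l ≟ m) →-dec (¬? (l ≟ k) →-dec (¬? (m ≟ k) →-dec ¬? (χ l m ≟ χ l k))))
      ; cover  = cover
      }
      where
      pt : Fin 4 → Fin n
      pt 0F = u
      pt 1F = v
      pt 2F = w
      pt 3F = w′

      -- Off the diagonal, the color in which the two labels agree; the diagonal entries are default
      -- values.
      χ : Fin 4 → Fin 4 → Fin 3
      χ l m = lookup (lookup table l) m
        where
        table : Vec (Vec (Fin 3) 4) 4
        table = (0F ∷ 0F ∷ 1F ∷ 2F ∷ []) ∷
                (0F ∷ 0F ∷ 2F ∷ 1F ∷ []) ∷
                (1F ∷ 2F ∷ 0F ∷ 0F ∷ []) ∷
                (2F ∷ 1F ∷ 0F ∷ 0F ∷ []) ∷ []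

      ww′ : OnlyColor 0F w w′
      ww′ = only₀ (λ 1ww′ → ¬1uv (R-trans 1uw (R-trans 1ww′ (R-sym 1vw′))))
                  (λ 2ww′ → ¬2uv (R-trans 2uw′ (R-sym (R-trans 2vw 2ww′))))

      uw : OnlyColor 1F u w
      uw = only₁ ¬0uw (λ 2uw → ¬2uv (R-trans 2uw (R-sym 2vw)))

      vw′ : OnlyColor 1F v w′
      vw′ = only₁ ¬0vw′ (λ 2vw′ → ¬2uv (R-trans 2uw′ (R-sym 2vw′)))

      uw′ : OnlyColor 2F u w′
      uw′ = only₂ (λ 0uw′ → ¬0vw′ (R-trans (R-sym (proj₁ uv)) 0uw′))
                  (λ 1uw′ → ¬1uv (R-trans 1uw′ (R-sym 1vw′)))

      vw : OnlyColor 2F v w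
      vw = only₂ (λ 0vw → ¬0uw (R-trans (proj₁ uv) 0vw))
                 (λ 1vw → ¬1uv (R-trans 1uw (R-sym 1vw)))

      only : ∀ l m → l ≢ m → OnlyColor (χ l m) (pt l) (pt m)
      only 0F 0F l≢l = contradiction refl l≢l
      only 0F 1F _   = uv
      only 0F 2F _   = uw
      only 0F 3F _   = uw′
      only 1F 0F _   = onlyColor-sym uv
      only 1F 1F l≢l = contradiction refl l≢l
      only 1F 2F _   = vw
      only 1F 3F _   = vw′
      only 2F 0F _   = onlyColor-sym uw
      only 2F 1F _   = onlyColor-sym vw
      only 2F 2F l≢l = contradiction refl l≢l
      only 2F 3F _   = ww′
      only 3F 0F _   = onlyColor-sym uw′
      only 3F 1F _   = onlyColor-sym vw′
      only 3F 2F _   = onlyColor-sym ww′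
      only 3F 3F l≢l = contradiction refl l≢l

      at : ∀ l {y} → R 0F (pt l) y → R 1F (pt l) y → R 2F (pt l) y → ∃[ l ] (∀ c → R c (pt l) y)
      at l r₀ r₁ r₂ = l , λ { 0F → r₀ ; 1F → r₁ ; 2F → r₂ }

      -- Inside the 0-class of `u`, agreeing with both `w` and `w′` forces the last two coordinates
      -- to be 00 or 11; outside it they are 01 or 10, and agreeing with `w′` or `w` respectively
      -- settles color 0.
      cover : ∀ y → ∃[ l ] (∀ c → R c (pt l) y)
      cover y with R? 0F u y
      cover y | yes 0uy with meet₃ w y | meet₃ w′ y
      ... | inj₁ 0wy        | _                = contradiction (R-trans 0uy (R-sym 0wy)) ¬0uw
      ... | inj₂ _          | inj₁ 0w′y        =
        contradiction (R-trans (R-sym (proj₁ uv)) (R-trans 0uy (R-sym 0w′y))) ¬0vw′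
      ... | inj₂ (inj₁ 1wy) | inj₂ (inj₁ 1w′y) =
        contradiction (R-trans 1uw (R-trans 1wy (R-sym (R-trans 1vw′ 1w′y)))) ¬1uv
      ... | inj₂ (inj₁ 1wy) | inj₂ (inj₂ 2w′y) = at 0F 0uy (R-trans 1uw 1wy) (R-trans 2uw′ 2w′y)
      ... | inj₂ (inj₂ 2wy) | inj₂ (inj₁ 1w′y) =
        at 1F (R-trans (R-sym (proj₁ uv)) 0uy) (R-trans 1vw′ 1w′y) (R-trans 2vw 2wy)
      ... | inj₂ (inj₂ 2wy) | inj₂ (inj₂ 2w′y) =
        contradiction (R-trans 2uw′ (R-trans 2w′y (R-sym (R-trans 2vw 2wy)))) ¬2uv
      cover y | no ¬0uy with outside-crosses ¬0uy
      ... | inj₁ (_ , 1uy , 2vy) with meet₃ w′ y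
      ...   | inj₁ 0w′y        = at 2F (R-trans (proj₁ ww′) 0w′y) (R-trans (R-sym 1uw) 1uy) (R-trans (R-sym 2vw) 2vy)
      ...   | inj₂ (inj₁ 1w′y) = contradiction (R-trans 1uy (R-sym (R-trans 1vw′ 1w′y))) ¬1uv
      ...   | inj₂ (inj₂ 2w′y) = contradiction (R-trans 2uw′ (R-trans 2w′y (R-sym 2vy))) ¬2uv
      cover y | no ¬0uy | inj₂ (_ , 1vy , 2uy) with meet₃ w y
      ...   | inj₁ 0wy        = at 3F (R-trans (R-sym (proj₁ ww′)) 0wy) (R-trans (R-sym 1vw′) 1vy) (R-trans (R-sym 2uw′) 2uy)
      ...   | inj₂ (inj₁ 1wy) = contradiction (R-trans 1uw (R-trans 1wy (R-sym 1vy))) ¬1uv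
      ...   | inj₂ (inj₂ 2wy) = contradiction (R-trans 2uy (R-sym (R-trans 2vw 2wy))) ¬2uv

-- Consequences of the bound when every component is small.

module _ {n : ℕ} {H : Hypergraph n} {a : ℕ} (bound : TransversalFreeBound H a) where
  open TransversalFreeBound bound using (size≤)

  -- No component has `n - a` or more vertices, phrased by complements because these enter the
  -- transversal-free triples.
  Small : ColorSystem H → Set
  Small S = ∀ c x → a < ∣ ∁ (class c x) ∣
    where open ColorSystem S

  module _ (S : ColorSystem H) (small : Small S) where
    open ColorSystem S

    nonspanning : ∀ c x → ∃[ y ] ¬ R c x y
    nonspanning c x with ∣p∣>0⇒nonempty (∁ (class c x)) (ℕ.≤-<-trans z≤n (small c x))
    ... | y , y∈ = y , ∉-class y∈

    -- Each vertex lies outside at most one of the three classes, so their complements are disjoint;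
    -- all have at least `a + 1` vertices, one too many for `size≤`.
    ¬twoOfThree : ¬ TwoOfThree S
    ¬twoOfThree (rep , two) = contradiction (size≤ (suc a) X (λ c → small c (rep c)) disjoint free) ℕ.1+n≰n
      where
      X : Fin 3 → Subset n
      X c = ∁ (class c (rep c))

      disjoint : ∀ {c d} → c ≢ d → ∀ {y} → y ∈ X c → y ∉ X d
      disjoint {c} {d} c≢d {y} y∈Xc y∈Xd with two y
      ... | b , near with c ≟ b
      ...   | yes refl = ∉-class y∈Xd (near d (≢-sym c≢d))
      ...   | no  c≢b  = ∉-class y∈Xc (near c c≢b)

      -- An edge of color c lies inside rep c's class or misses it; in the
      -- latter case it lies in X c and so avoids the other two sets.
      free : ∀ e → ∃[ c ] (∀ {x} → x ∈ edge H e → x ∉ X c)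
      free e with nonempty? (edge H e ∩ X (color e))
      ... | no  empty   = color e , λ x∈e x∈X → empty (_ , x∈p∩q⁺ (x∈e , x∈X))
      ... | yes (x , x∈) with x∈p∩q⁻ _ _ x∈
      ...   | x∈e , x∈X = punchIn (color e) 0F , λ {y} y∈e →
        disjoint (≢-sym (punchInᵢ≢i (color e) 0F))
                 (∁class⁺ (λ ry → ∉-class x∈X (R-trans ry (mono y∈e x∈e))))

    -- A vertex outside the 0-class of `u` crosses one way; if none crossed the other way,
    -- `twoOfThree` would apply. The second case is the first with `u` and `v` exchanged.
    onlyColor₀⇒fourPoints : ∀ {u v} → OnlyColor S 0F u v → FourPoints S
    onlyColor₀⇒fourPoints {u} {v} uv with nonspanning 0F u
    ... | w , ¬0uw with outside-crosses S uv ¬0uw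
    ...   | inj₁ w-cross with any? (cross? S v u)
    ...     | yes (w′ , w′-cross) = fourPoints S uv w-cross w′-cross
    ...     | no  none            = contradiction (twoOfThree S uv w-cross (λ x → none ∘ (x ,_))) ¬twoOfThree
    onlyColor₀⇒fourPoints {u} {v} uv | w , ¬0uw | inj₂ w-cross with any? (cross? S u v)
    ...     | yes (w′ , w′-cross) = fourPoints S uv w′-cross w-cross
    ...     | no  none            =
      contradiction (twoOfThree S (onlyColor-sym S uv) w-cross (λ x → none ∘ (x ,_))) ¬twoOfThree

  relabelled-fourPoints : Fin n → (S : ColorSystem H) → Small S → ∃[ σ ] FourPoints (relabel σ S)
  relabelled-fourPoints x S small with onlyColor-pair S (nonspanning S small) x
  ... | i , u , v , uv , only = σ , onlyColor₀⇒fourPoints (relabel σ S) (λ c → small (σ ⟨$⟩ʳ c))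
                                      (uv , λ r → ⟨$⟩ʳ-injective σ (only r))
    where
    σ : Permutation′ 3
    -- Color 0 of the relabelled system is color `i` of `S`.
    σ = transpose 0F i

  -- The four parts, their colors and their sizes.

  module _ (S : ColorSystem H) (F : FourPoints S) where
    open ColorSystem S
    open FourPoints F

    inPart? : ∀ l x → Dec (∀ c → R c (v l) x)
    inPart? l x = all? λ c → R? c (v l) x

    part : Fin 4 → Subset n
    part l = comprehension (inPart? l)

    ∈-part⁺ : ∀ {l x} → (∀ c → R c (v l) x) → x ∈ part l
    ∈-part⁺ {l} = ∈-comprehension⁺ (inPart? l)

    ∈-part⁻ : ∀ {l x} → x ∈ part l → ∀ c → R c (v l) x
    ∈-part⁻ {l} = ∈-comprehension⁻ (inPart? l)

    part-cover : ∀ x → ∃[ l ] (x ∈ part l)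
    part-cover x with cover x
    ... | l , lx = l , ∈-part⁺ lx

    -- Members of a part carry the label of its point, so `x` and `y` share only the color that
    -- `v l` and `v m` share.
    between : ∀ {l m x y c} → l ≢ m → x ∈ part l → y ∈ part m → R c x y → c ≡ χ l m
    between {c = c} l≢m x∈ y∈ xy =
      proj₂ (only _ _ l≢m) (R-trans (∈-part⁻ x∈ c) (R-trans xy (R-sym (∈-part⁻ y∈ c))))

    crossing : ∀ {l m e} → l ≢ m → Meets H e (part l) → Meets H e (part m) → color e ≡ χ l m
    crossing {l} {m} {e} l≢m (x , x∈) (y , y∈) =
      let x∈e , x∈l = x∈p∩q⁻ (edge H e) (part l) x∈
          y∈e , y∈m = x∈p∩q⁻ (edge H e) (part m) y∈
      in between l≢m x∈l y∈m (mono x∈e y∈e)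

    -- A common vertex is joined to itself in colors 0 and 1, and `between` would make both equal to
    -- `χ l m`.
    part-disjoint : ∀ {l m} → l ≢ m → ∀ {x} → x ∈ part l → x ∉ part m
    part-disjoint l≢m x∈l x∈m =
      0≢1+n (trans (between {c = 0F} l≢m x∈l x∈m R-refl) (sym (between {c = 1F} l≢m x∈l x∈m R-refl)))

    part-partition : IsPartition part
    part-partition = record
      { nonempty = λ l → v l , ∈-part⁺ (λ c → R-refl)
      ; disjoint = λ l m l≢m (x , x∈) →
          let x∈l , x∈m = x∈p∩q⁻ (part l) (part m) x∈ in part-disjoint l≢m x∈l x∈m
      ; cover    = part-cover
      }

    noEdgeInThreeParts : ∀ e i j k → i ≢ j → i ≢ k → j ≢ k →
      ¬ (Meets H e (part i) × Meets H e (part j) × Meets H e (part k))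
    noEdgeInThreeParts e i j k i≢j i≢k j≢k (ei , ej , ek) =
      proper i j k i≢j i≢k j≢k (trans (sym (crossing i≢j ei ej)) (crossing i≢k ei ek))

    χ-sym : ∀ {l m} → l ≢ m → χ l m ≡ χ m l
    χ-sym l≢m = proj₂ (only _ _ (≢-sym l≢m)) (R-sym (proj₁ (only _ _ l≢m)))

    -- The edge of K₄ from `k` to `l` differs in color from those from `i` to `k` and from `i` to
    -- `l`, which leaves only the third color at `i`.
    χ-opposite : ∀ i j k l → i ≢ j → i ≢ k → i ≢ l → j ≢ k → j ≢ l → k ≢ l → χ k l ≡ χ i j
    χ-opposite i j k l i≢j i≢k i≢l j≢k j≢l k≢l = third (χ i j) (χ i k) (χ i l) (χ k l)
      (proper i j k i≢j i≢k j≢k) (proper i j l i≢j i≢l j≢l) (proper i k l i≢k i≢l k≢l)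
      (λ eq → proper k l i k≢l (≢-sym i≢k) (≢-sym i≢l) (trans eq (χ-sym i≢k)))
      (λ eq → proper l k i (≢-sym k≢l) (≢-sym i≢l) (≢-sym i≢k)
                (trans (sym (χ-sym k≢l)) (trans eq (χ-sym i≢l))))

    -- Renames the colors so that the edges from part 0F become blue, red, green.
    standard : Fin 3 → Fin 3
    standard d = if does (d ≟ χ 0F 1F) then blue else if does (d ≟ χ 0F 2F) then red else green

    standard-blue : ∀ {d} → d ≡ χ 0F 1F → standard d ≡ blue
    standard-blue refl rewrite dec-true (χ 0F 1F ≟ χ 0F 1F) refl = refl

    standard-red : ∀ {d} → d ≡ χ 0F 2F → standard d ≡ red
    standard-red refl
      rewrite dec-false (χ 0F 2F ≟ χ 0F 1F) (proper 0F 2F 1F (λ ()) (λ ()) (λ ()))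
            | dec-true (χ 0F 2F ≟ χ 0F 2F) refl = refl

    standard-green : ∀ {d} → d ≡ χ 0F 3F → standard d ≡ green
    standard-green refl
      rewrite dec-false (χ 0F 3F ≟ χ 0F 1F) (proper 0F 3F 1F (λ ()) (λ ()) (λ ()))
            | dec-false (χ 0F 3F ≟ χ 0F 2F) (proper 0F 3F 2F (λ ()) (λ ()) (λ ())) = refl

    standardColoring : Coloring H 3
    standardColoring = tabulate (standard ∘ color)

    crossing-color : ∀ {l m d} → l ≢ m → standard (χ l m) ≡ d →
      ∀ e → Meets H e (part l) → Meets H e (part m) → lookup standardColoring e ≡ d
    crossing-color l≢m χ≡d e el em =
      trans (lookup∘tabulate (standard ∘ color) e) (trans (cong standard (crossing l≢m el em)) χ≡d)

    -- Otherwise part l, part m and everything outside the component joining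
    -- them would form a transversal-free triple of sets larger than a.
    smallPart : Small S → ∀ {l m} → l ≢ m → ∣ part m ∣ ≤ ∣ part l ∣ → ∣ part m ∣ ≤ a
    smallPart small {l} {m} l≢m m≤l = ℕ.≮⇒≥ λ a<m → contradiction (size≤ (suc a) X (large a<m) disjoint free) ℕ.1+n≰n
      where
      rest : Subset n
      rest = ∁ (class (χ l m) (v l))

      X : Fin 3 → Subset n
      X 0F = part l
      X 1F = part m
      X 2F = rest

      large : a < ∣ part m ∣ → ∀ i → a < ∣ X i ∣
      large a<m 0F = ℕ.<-≤-trans a<m m≤l
      large a<m 1F = a<m
      large a<m 2F = small (χ l m) (v l)

      l-rest : ∀ {x} → x ∈ part l → x ∉ rest
      l-rest x∈l x∈rest = ∉-class x∈rest (∈-part⁻ x∈l (χ l m))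

      m-rest : ∀ {x} → x ∈ part m → x ∉ rest
      m-rest x∈m x∈rest = ∉-class x∈rest (R-trans (proj₁ (only l m l≢m)) (∈-part⁻ x∈m (χ l m)))

      disjoint : ∀ {i j} → i ≢ j → ∀ {x} → x ∈ X i → x ∉ X j
      disjoint {0F} {0F} i≢i _ _ = i≢i refl
      disjoint {0F} {1F} _       = part-disjoint l≢m
      disjoint {0F} {2F} _       = l-rest
      disjoint {1F} {0F} _       = part-disjoint (≢-sym l≢m)
      disjoint {1F} {1F} i≢i _ _ = i≢i refl
      disjoint {1F} {2F} _       = m-rest
      disjoint {2F} {0F} _ x∈ y∈ = l-rest y∈ x∈
      disjoint {2F} {1F} _ x∈ y∈ = m-rest y∈ x∈
      disjoint {2F} {2F} i≢i _ _ = i≢i refl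

      free : ∀ e → ∃[ i ] (∀ {x} → x ∈ edge H e → x ∉ X i)
      free e with nonempty? (edge H e ∩ part l) | nonempty? (edge H e ∩ part m)
      ... | no  empty | _         = 0F , λ x∈e x∈l → empty (_ , x∈p∩q⁺ (x∈e , x∈l))
      ... | yes _     | no  empty = 1F , λ x∈e x∈m → empty (_ , x∈p∩q⁺ (x∈e , x∈m))
      -- An edge meeting both parts has color `χ l m`, hence lies in the component that joins them.
      ... | yes el@(y , y∈) | yes em = 2F , λ x∈e x∈rest →
        let y∈e , y∈l = x∈p∩q⁻ (edge H e) (part l) y∈ in
        ∉-class x∈rest (R-trans (∈-part⁻ y∈l (χ l m))
          (subst (λ c → R c _ _) (crossing l≢m el em) (mono y∈e x∈e)))

    module _ (≤a : ∀ i → i ≢ 0F → ∣ part i ∣ ≤ a) where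

      parts≥ : ∀ i → i ≢ 0F → n ∸ 2 * a ≤ ∣ part 0F ∣ + ∣ part i ∣
      parts≥ i i≢0 = ℕ.≤-trans (union i i≢0) (∣p∪q∣≤∣p∣+∣q∣ (part 0F) (part i))
        where
        first : ∀ i {x} → x ∈ part 0F → x ∈ part 0F ∪ part i
        first i x∈ = x∈p∪q⁺ (inj₁ x∈)

        second : ∀ i {x} → x ∈ part i → x ∈ part 0F ∪ part i
        second i x∈ = x∈p∪q⁺ {p = part 0F} (inj₂ x∈)

        union : ∀ i → i ≢ 0F → n ∸ 2 * a ≤ ∣ part 0F ∪ part i ∣
        union 0F 0≢0 = contradiction refl 0≢0
        union 1F _ = remainder-large _ (part 2F) (part 3F) (≤a 2F λ ()) (≤a 3F λ ()) λ x → case part-cover x of λ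
          { (0F , x∈) → inj₁ (first 1F x∈) ; (1F , x∈) → inj₁ (second 1F x∈)
          ; (2F , x∈) → inj₂ (inj₁ x∈)     ; (3F , x∈) → inj₂ (inj₂ x∈) }
        union 2F _ = remainder-large _ (part 1F) (part 3F) (≤a 1F λ ()) (≤a 3F λ ()) λ x → case part-cover x of λ
          { (0F , x∈) → inj₁ (first 2F x∈) ; (2F , x∈) → inj₁ (second 2F x∈)
          ; (1F , x∈) → inj₂ (inj₁ x∈)     ; (3F , x∈) → inj₂ (inj₂ x∈) }
        union 3F _ = remainder-large _ (part 1F) (part 2F) (≤a 1F λ ()) (≤a 2F λ ()) λ x → case part-cover x of λ
          { (0F , x∈) → inj₁ (first 3F x∈) ; (3F , x∈) → inj₁ (second 3F x∈)
          ; (1F , x∈) → inj₂ (inj₁ x∈)     ; (2F , x∈) → inj₂ (inj₂ x∈) }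

      -- The component of `v 0F` in color `χ 0F 1F` contains parts 0 and 1, so it misses only
      -- vertices of two parts of size at most `a`.
      class≥ : ∃[ c ] ∃[ x ] (n ∸ 2 * a ≤ ∣ class c x ∣)
      class≥ = χ 0F 1F , v 0F , remainder-large _ (part 2F) (part 3F) (≤a 2F λ ()) (≤a 3F λ ()) λ x → case part-cover x of λ
        { (0F , x∈) → inj₁ (∈-class⁺ (∈-part⁻ x∈ (χ 0F 1F)))
        ; (1F , x∈) → inj₁ (∈-class⁺ (R-trans (proj₁ (only 0F 1F λ ())) (∈-part⁻ x∈ (χ 0F 1F))))
        ; (2F , x∈) → inj₂ (inj₁ x∈)
        ; (3F , x∈) → inj₂ (inj₂ x∈) }

  record SortedFourPoints (S : ColorSystem H) : Set where
    field
      points     : FourPoints S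
      descending : Descending (∣_∣ ∘ part S points)
      ≤a         : ∀ i → i ≢ 0F → ∣ part S points i ∣ ≤ a

  -- Once sorted, part 0 is at least as large as every other part, so `smallPart` bounds all the
  -- others by `a`.
  sortedFourPoints : ∀ S → Small S → FourPoints S → SortedFourPoints S
  sortedFourPoints S small F with sorting (∣_∣ ∘ part S F)
  ... | τ , descending = record
    { points     = reorder S τ F
    ; descending = λ {i} {j} → descending {i} {j}
    ; ≤a         = λ i i≢0 → smallPart S (reorder S τ F) small (≢-sym i≢0) (descending z≤n)
    }

  -- The four parts may come from a relabelled system, as the structure has its own coloring; the
  -- large class is translated back to `S` through `σ`, since it must yield a component of the given
  -- coloring.
  small⇒fourPoints : Fin n → (S : ColorSystem H) → Small S → let open ColorSystem S in
    ∃ SortedFourPoints × ∃[ c ] ∃[ x ] (n ∸ 2 * a ≤ ∣ class c x ∣)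
  small⇒fourPoints x S small =
    let σ , F         = relabelled-fourPoints x S small
        G             = sortedFourPoints (relabel σ S) (λ c → small (σ ⟨$⟩ʳ c)) F
        c , y , large = class≥ (relabel σ S) (SortedFourPoints.points G) (SortedFourPoints.≤a G)
    in (relabel σ S , G) , σ ⟨$⟩ʳ c , y , large

-- From color systems back to hypergraph colorings.

fourPartStructure : ∀ {n} (H : Hypergraph n) → ∃ (SortedFourPoints (α₃*-bound H)) → FourPartStructure H
fourPartStructure H (S , G) = record
  { coloring     = standardColoring b S F
  ; V            = part b S F
  ; isPartition  = part-partition b S F
  ; V₁≥V₂        = descending z≤n
  ; V₂≥V₃        = descending {1F} {2F} (s≤s z≤n)
  ; V₃≥V₄        = descending {2F} {3F} (s≤s (s≤s z≤n))
  ; α≥V₂         = ≤a 1F λ ()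
  ; V₁+Vᵢ        = parts≥ b S F ≤a
  ; noThreeParts = noEdgeInThreeParts b S F
  ; blue₁₂       = crossing-color b S F (λ ()) (standard-blue b S F refl)
  ; blue₃₄       = crossing-color b S F (λ ())
                     (standard-blue b S F (opposite 0F 1F 2F 3F (λ ()) (λ ()) (λ ()) (λ ()) (λ ()) (λ ())))
  ; red₁₃        = crossing-color b S F (λ ()) (standard-red b S F refl)
  ; red₂₄        = crossing-color b S F (λ ())
                     (standard-red b S F (opposite 0F 2F 1F 3F (λ ()) (λ ()) (λ ()) (λ ()) (λ ()) (λ ())))
  ; green₁₄      = crossing-color b S F (λ ()) (standard-green b S F refl)
  ; green₂₃      = crossing-color b S F (λ ())
                     (standard-green b S F (opposite 0F 3F 1F 2F (λ ()) (λ ()) (λ ()) (λ ()) (λ ()) (λ ())))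
  }
  where
  open SortedFourPoints G renaming (points to F)
  b = α₃*-bound H
  opposite = χ-opposite b S F

someVertex : ∀ {n} → NonZero n → Fin n
someVertex {suc n} _ = zero

small-or-large : ∀ {n} {H : Hypergraph n} (S : ColorSystem H) a → let open ColorSystem S in
  (∃[ c ] ∃[ x ] (n ∸ a ≤ ∣ class c x ∣)) ⊎ (∀ c x → a < ∣ ∁ (class c x) ∣)
small-or-large {n} S a with any? (λ c → any? λ x → ∣ ∁ (ColorSystem.class S c x) ∣ ℕ.≤? a)
... | no  none           = inj₂ λ c x → ℕ.≰⇒> λ ≤a → none (c , x , ≤a)
... | yes (c , x , ∁≤a) = inj₁ (c , x , ℕ.m≤n+o⇒m∸n≤o n a (begin
  n                    ≤⟨ ℕ.m≤n+m∸n n ∣ p ∣ ⟩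
  ∣ p ∣ + (n ∸ ∣ p ∣)  ≡⟨ cong (∣ p ∣ +_) (∣∁p∣≡n∸∣p∣ p) ⟨
  ∣ p ∣ + ∣ ∁ p ∣      ≤⟨ ℕ.+-monoʳ-≤ ∣ p ∣ ∁≤a ⟩
  ∣ p ∣ + a            ≡⟨ ℕ.+-comm ∣ p ∣ a ⟩
  a + ∣ p ∣            ∎))
  where
  open ℕ.≤-Reasoning
  p = ColorSystem.class S c x

largeClass-or-fourParts : ∀ {n} (H : Hypergraph n) (S : ColorSystem H) → let open ColorSystem S in
  (∃[ c ] ∃[ x ] (n ∸ α₃* H ≤ ∣ class c x ∣)) ⊎
  (FourPartStructure H × ∃[ c ] ∃[ x ] (n ∸ 2 * α₃* H ≤ ∣ class c x ∣))
largeClass-or-fourParts H S =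
  map₂ (map₁× (fourPartStructure H) ∘ small⇒fourPoints (α₃*-bound H) (someVertex (nonZero H)) S)
       (small-or-large S (α₃* H))

module _ {n : ℕ} (H : Hypergraph n) (δ≥1 : δ₂[ H ]≥ 1) where

  commonEdge : ∀ {x y} → x ≢ y → ∃[ e ] (x ∈ edge H e × y ∈ edge H e)
  commonEdge {x} {y} x≢y with ∣p∣>0⇒nonempty _ (δ≥1 x y x≢y)
  ... | e , e∈ = e , ∈-comprehension⁻ (λ e → (x ∈? edge H e) ×-dec (y ∈? edge H e)) e∈

  colorSystem : Coloring H 3 → ColorSystem H
  colorSystem c = record
    { R                = Joined H c
    ; isDecEquivalence = joined-isDecEquivalence H c
    ; meet             = meet
    ; color            = lookup c
    ; mono             = edge-joined H c _ refl
    }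
    where
    meet : ∀ x y → ∃[ i ] Joined H c i x y
    meet x y with x ≟ y
    ... | yes refl = 0F , ε
    ... | no  x≢y with commonEdge x≢y
    ...   | e , x∈e , y∈e = lookup c e , edge-joined H c _ refl x∈e y∈e

  largeClass⇒component : ∀ {m} c → let open ColorSystem (colorSystem c) in
    (∃[ i ] ∃[ x ] (m ≤ ∣ class i x ∣)) → HasMonochromaticComponent≥ H m c
  largeClass⇒component c (i , x , m≤) = i , _ , component H c i x , m≤

  component-or-fourParts : ∀ c →
    HasMonochromaticComponent≥ H (n ∸ α₃* H) c ⊎
    (FourPartStructure H × HasMonochromaticComponent≥ H (n ∸ 2 * α₃* H) c)
  component-or-fourParts c =
    map (largeClass⇒component c) (map₂× (largeClass⇒component c)) (largeClass-or-fourParts H (colorSystem c))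

  component≥n∸2α : ∀ c → HasMonochromaticComponent≥ H (n ∸ 2 * α₃* H) c
  component≥n∸2α c = [ weaken , proj₂ ]′ (component-or-fourParts c)
    where
    weaken : HasMonochromaticComponent≥ H (n ∸ α₃* H) c → HasMonochromaticComponent≥ H (n ∸ 2 * α₃* H) c
    weaken (i , C , isC , large) =
      -- `2 * α₃* H` computes to `α₃* H + (α₃* H + 0)`.
      i , C , isC , ℕ.≤-trans (ℕ.∸-monoʳ-≤ n (ℕ.m≤m+n (α₃* H) (α₃* H + 0))) large

mc≥ : ∀ {n} (H : Hypergraph n) m → m ≤ n → EveryColoringHas≥ H 3 m → mc 3 H ≥ m
mc≥ {n} H m m≤n every = greatest-upper (everyColoringHas≥? H 3) n every m≤n

-- `Q` is independent of the coloring: by decidability, either `P` holds for all colorings or a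
-- single exception already yields `Q`.
every-or : ∀ {r k} {P : Pred (Vec (Fin r) k) 0ℓ} {Q : Set} → Decidable P → (∀ c → P c ⊎ Q) → (∀ c → P c) ⊎ Q
every-or P? P⊎Q with any-Vec? any? (¬? ∘ P?)
... | no  none     = inj₁ λ c → decidable-stable (P? c) (none ∘ (c ,_))
... | yes (c , ¬p) = inj₂ ([ (λ p → contradiction p ¬p) , (λ q → q) ]′ (P⊎Q c))

theorem2p3 : ∀ (n : ℕ) (H : Hypergraph n) → Uniform 3 H → δ₂[ H ]≥ 1 →
    (mc 3 H ≥ n ∸ α₃* H ⊎ FourPartStructure H) ×
    mc 3 H ≥ n ∸ 2 * α₃* H
theorem2p3 n H _ δ≥1 =
  map₁ (mc≥ H (n ∸ α₃* H) (ℕ.m∸n≤m n (α₃* H))) everyComponent-or-fourParts ,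
  mc≥ H (n ∸ 2 * α₃* H) (ℕ.m∸n≤m n (2 * α₃* H)) (component≥n∸2α H δ≥1)
  where
  Large : Coloring H 3 → Set
  Large = HasMonochromaticComponent≥ H (n ∸ α₃* H)

  everyComponent-or-fourParts : EveryColoringHas≥ H 3 (n ∸ α₃* H) ⊎ FourPartStructure H
  everyComponent-or-fourParts =
    every-or {P = Large} {Q = FourPartStructure H} (hasMonochromaticComponent≥? H (n ∸ α₃* H))
      (map₂ proj₁ ∘ component-or-fourParts H δ≥1)
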